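{- Let $\mathbf{A},\mathbf{B}$ be Medvedev degrees such that the open interval $(\mathbf{A},\mathbf{B})=\{\mathbf{X}: \mathbf{A}<_M\mathbf{X}<_M\mathbf{B}\}$ is nonempty. Then there are two Medvedev degrees in $(\mathbf{A},\mathbf{B})$ that are incomparable under $\le_M$.
   Context: A mass problem is a subset of Baire space $\omega^\omega$. For mass problems $\mathcal{A},\mathcal{B}$, $\mathcal{A}\le_M\mathcal{B}$ (Medvedev reducibility) iff there is a partial Turing functional $\Psi$ such that for every $f\in\mathcal{B}$, $\Psi(f)$ is defined and $\Psi(f)\in\mathcal{A}$; $\equiv_M$ is the induced equivalence relation and its classes are the Medvedev degrees, partially ordered by $\le_M$. -}

module Defs where

open import Data.Nat using (ℕ; zero; suc; _<_)
open import Data.Fin using (Fin)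
open import Data.Vec using (Vec; []; _∷_; lookup)
open import Data.Product using (Σ; ∃; _×_; _,_)
open import Relation.Nullary using (¬_)

Baire : Set
Baire = ℕ → ℕ

MassProblem : Set₁
MassProblem = Baire → Set

-- Codes for partial recursive functions relative to an oracle f : ℕ → ℕ
-- (Kleene's μ-recursive functions with an extra oracle basic function).
-- Code n = code of an n-ary partial function.
data Code : ℕ → Set where
  zer  : ∀ {n} → Code n
  sucᶜ : Code 1
  proj : ∀ {n} → Fin n → Code n
  orc  : Code 1
  comp : ∀ {m n} → Code m → (Fin m → Code n) → Code n
  prec : ∀ {n} → Code n → Code (suc (suc n)) → Code (suc n)
  mu   : ∀ {n} → Code (suc n) → Code n

data Eval (f : Baire) : ∀ {n} → Code n → Vec ℕ n → ℕ → Set where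
  e-zer  : ∀ {n} {xs : Vec ℕ n} → Eval f zer xs 0
  e-suc  : ∀ {x} → Eval f sucᶜ (x ∷ []) (suc x)
  e-proj : ∀ {n} {i : Fin n} {xs} → Eval f (proj i) xs (lookup xs i)
  e-orc  : ∀ {x} → Eval f orc (x ∷ []) (f x)
  e-comp : ∀ {m n} {g : Code m} {hs : Fin m → Code n} {xs : Vec ℕ n} {ys : Vec ℕ m} {y} →
           (∀ i → Eval f (hs i) xs (lookup ys i)) → Eval f g ys y →
           Eval f (comp g hs) xs y
  e-prec0 : ∀ {n} {g : Code n} {s : Code (suc (suc n))} {xs y} →
            Eval f g xs y → Eval f (prec g s) (0 ∷ xs) y
  e-precS : ∀ {n} {g : Code n} {s : Code (suc (suc n))} {k xs y z} →
            Eval f (prec g s) (k ∷ xs) y → Eval f s (k ∷ y ∷ xs) z →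
            Eval f (prec g s) (suc k ∷ xs) z
  e-mu   : ∀ {n} {g : Code (suc n)} {xs : Vec ℕ n} {y} →
           Eval f g (y ∷ xs) 0 →
           (∀ z → z < y → ∃ λ k → Eval f g (z ∷ xs) (suc k)) →
           Eval f (mu g) xs y

-- A (partial) Turing functional is given by a unary code e;
-- Ψ_e(f) is defined and equals g iff for every n, Φ_e^f(n)↓ = g n.
_⟨_⟩≃_ : Code 1 → Baire → Baire → Set
e ⟨ f ⟩≃ g = ∀ n → Eval f e (n ∷ []) (g n)

_≤M_ : MassProblem → MassProblem → Set
𝒜 ≤M ℬ = Σ (Code 1) λ e → ∀ f → ℬ f → Σ Baire λ g → (e ⟨ f ⟩≃ g) × 𝒜 g

_<M_ : MassProblem → MassProblem → Set
𝒜 <M ℬ = 𝒜 ≤M ℬ × ¬ (ℬ ≤M 𝒜)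

_|M_ : MassProblem → MassProblem → Set
𝒜 |M ℬ = ¬ (𝒜 ≤M ℬ) × ¬ (ℬ ≤M 𝒜)

{-# OPTIONS --safe #-}

-- Call P evading for B if no single functional maps a tagged copy of P into B ⊓ L for a finite set L
-- of tagged members of P. A stage construction with fresh numeric tags then produces C₀, C₁ above P
-- with B ⊓ C₀ and B ⊓ C₁ incomparable. If B ≰ P although every member of P computes a member of B,
-- then P is evading, since finite sets of such members compute B uniformly. So for 𝒜 < 𝒳 < ℬ one may
-- assume that some f ∈ 𝒜 computes no member of 𝒳 and some c ∈ 𝒳 no member of ℬ; in particular f does
-- not compute c. If c does not compute f, then ℬ ⊓ {c} and ℬ ⊓ {f} are incomparable. Otherwise the
-- problem of all f ⊕ x with x a finite variant of c is evading for ℬ: a functional mapping it into a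
-- finite set would, on all extensions of some finite string, always give the same z computing c, and
-- f could compute z by searching for convergent computations from finite strings.
module Submission where

open import Defs
open import Level using (0ℓ)
open import Axiom.ExcludedMiddle using (ExcludedMiddle)
open import Data.Bool using (Bool; true; false; not; if_then_else_)
import Data.Bool.Properties as Bool
open import Data.Empty using (⊥-elim)
open import Data.Fin using (Fin; zero; suc; toℕ; fromℕ<)
open import Data.Fin.Properties using (toℕ-fromℕ<; fromℕ<-toℕ; toℕ<n)
open import Data.List using (List; []; _∷_)
open import Data.List.Membership.Propositional using (_∈_)
open import Data.List.Relation.Unary.All as All using (All; []; _∷_)
open import Data.List.Relation.Unary.Any using (Any; here; there)
open import Data.Nat hiding (_⊓_)
open import Data.Nat.Properties
open import Data.Product using (Σ; _×_; _,_; proj₁; proj₂)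
open import Data.Sum using (_⊎_; inj₁; inj₂)
open import Data.Vec using (Vec; []; _∷_; lookup; tail; tabulate)
open import Data.Vec.Properties using (lookup∘tabulate; tabulate∘lookup; tabulate-cong)
open import Function using (_∘_; id)
open import Relation.Binary.Definitions using (tri<; tri≈; tri>)
open import Relation.Binary.PropositionalEquality
open import Relation.Nullary using (¬_; Dec; yes; no)
open import Relation.Nullary.Decidable using (decidable-stable)

-- Total computable functions

natrec : ℕ → (ℕ → ℕ → ℕ) → ℕ → ℕ
natrec z s zero    = z
natrec z s (suc k) = s k (natrec z s k)

ifz : ℕ → ℕ → ℕ → ℕ
ifz z a b = natrec a (λ _ _ → b) z

-- One code must serve every oracle of the family `o`. With `I` the members of a mass problem this
-- is exactly the uniformity that `≤M` demands.
Comp : {I : Set} → (I → Baire) → {n : ℕ} → (I → Vec ℕ n → ℕ) → Set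
Comp o {n} F = Σ (Code n) λ c → ∀ i xs → Eval (o i) c xs (F i xs)

record CompV {I : Set} (o : I → Baire) {n m : ℕ} (A : I → Vec ℕ n → Vec ℕ m) : Set where
  constructor components
  field at : ∀ j → Comp o (λ i v → lookup (A i v) j)

open CompV

least-zero : (P : ℕ → ℕ) → ∀ u → P u ≡ 0 → Σ ℕ λ m → P m ≡ 0 × (∀ z → z < m → P z ≢ 0)
least-zero P u Pu with P 0 in eq0
... | zero = 0 , eq0 , λ z ()
least-zero P zero Pu | suc _ = ⊥-elim (1+n≢0 (trans (sym eq0) Pu))
least-zero P (suc u) Pu | suc _ with least-zero (P ∘ suc) u Pu
... | m , Pm , below = suc m , Pm , λ
  { zero z<m P0 → 1+n≢0 (trans (sym eq0) P0)
  ; (suc z) (s≤s z<m) → below z z<m }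

module _ {I : Set} {o : I → Baire} where

  comp-ext : ∀ {n} {F G : I → Vec ℕ n → ℕ} →
             (∀ i v → F i v ≡ G i v) → Comp o F → Comp o G
  comp-ext F≗G (c , h) = c , λ i v → subst (Eval (o i) c v) (F≗G i v) (h i v)

  var : ∀ {n} (j : Fin n) → Comp o (λ i v → lookup v j)
  var j = proj j , λ i v → e-proj

  oracle : ∀ {n} {F : I → Vec ℕ n → ℕ} → Comp o F → Comp o (λ i v → o i (F i v))
  oracle {F = F} (c , h) =
    comp orc (λ _ → c) ,
    λ i v → e-comp {ys = F i v ∷ []} (λ { zero → h i v }) e-orc

  _⟦_⟧ : ∀ {m n} {F : I → Vec ℕ m → ℕ} {A : I → Vec ℕ n → Vec ℕ m} →
         Comp o F → CompV o A → Comp o (λ i v → F i (A i v))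
  _⟦_⟧ {A = A} (c , h) a =
    comp c (λ j → proj₁ (at a j)) ,
    λ i v → e-comp {ys = A i v} (λ j → proj₂ (at a j) i v) (h i (A i v))

  nil : ∀ {n} → CompV o {n} (λ i v → [])
  nil = components λ ()

  _◂_ : ∀ {m n} {F : I → Vec ℕ n → ℕ} {A : I → Vec ℕ n → Vec ℕ m} →
        Comp o F → CompV o A → CompV o (λ i v → F i v ∷ A i v)
  f ◂ a = components λ { zero → f ; (suc j) → at a j }

  infixr 5 _◂_

  ids : ∀ {n} → CompV o {n} (λ i v → v)
  ids = components var

  drop₁ : ∀ {n} → CompV o {suc n} (λ i v → tail v)
  drop₁ = components λ j → proj (suc j) , λ { i (x ∷ xs) → e-proj }

  drop₂ : ∀ {n} → CompV o {suc (suc n)} (λ i v → tail (tail v))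
  drop₂ = components λ j → proj (suc (suc j)) , λ { i (x ∷ y ∷ xs) → e-proj }

  suc-c : ∀ {n} {F : I → Vec ℕ n → ℕ} → Comp o F → Comp o (λ i v → suc (F i v))
  suc-c {F = F} (c , h) =
    comp sucᶜ (λ _ → c) ,
    λ i v → e-comp {ys = F i v ∷ []} (λ { zero → h i v }) e-suc

  const-c : ∀ {n} k → Comp o {n} (λ i v → k)
  const-c zero    = zer , λ i v → e-zer
  const-c (suc k) = suc-c (const-c k)

  rec-c : ∀ {n} {G K : I → Vec ℕ n → ℕ} (S : I → Vec ℕ (suc (suc n)) → ℕ) →
          Comp o G → Comp o S → Comp o K →
          Comp o (λ i v → natrec (G i v) (λ k r → S i (k ∷ r ∷ v)) (K i v))
  rec-c {n} {G} S (g , hg) (s , hs) k = (prec g s , run) ⟦ k ◂ ids ⟧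
    where
    F : I → Vec ℕ (suc n) → ℕ
    F i (k ∷ v) = natrec (G i v) (λ k r → S i (k ∷ r ∷ v)) k
    run : ∀ i xs → Eval (o i) (prec g s) xs (F i xs)
    run i (zero ∷ v)  = e-prec0 (hg i v)
    run i (suc k ∷ v) = e-precS (run i (k ∷ v)) (hs i _)

  ifz-c : ∀ {n} {Z A B : I → Vec ℕ n → ℕ} → Comp o Z → Comp o A → Comp o B →
          Comp o (λ i v → ifz (Z i v) (A i v) (B i v))
  ifz-c {B = B} z a b = rec-c (λ i w → B i (tail (tail w))) a (b ⟦ drop₂ ⟧) z

  pred-c : ∀ {n} {F : I → Vec ℕ n → ℕ} → Comp o F → Comp o (λ i v → pred (F i v))
  pred-c {F = F} f =
    comp-ext (λ i v → eq (F i v)) (rec-c (λ i w → lookup w zero) (const-c 0) (var zero) f)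
    where
    eq : ∀ n → natrec 0 (λ k r → k) n ≡ pred n
    eq zero    = refl
    eq (suc n) = refl

  add-c : ∀ {n} {F G : I → Vec ℕ n → ℕ} → Comp o F → Comp o G →
          Comp o (λ i v → F i v + G i v)
  add-c {F = F} {G} f g =
    comp-ext (λ i v → eq (F i v) (G i v))
      (rec-c (λ i w → suc (lookup w (suc zero))) g (suc-c (var (suc zero))) f)
    where
    eq : ∀ a b → natrec b (λ k r → suc r) a ≡ a + b
    eq zero b    = refl
    eq (suc a) b = cong suc (eq a b)

  monus-c : ∀ {n} {F G : I → Vec ℕ n → ℕ} → Comp o F → Comp o G →
            Comp o (λ i v → F i v ∸ G i v)
  monus-c {F = F} {G} f g =
    comp-ext (λ i v → eq (F i v) (G i v))
      (rec-c (λ i w → pred (lookup w (suc zero))) f (pred-c (var (suc zero))) g)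
    where
    eq : ∀ a b → natrec a (λ k r → pred r) b ≡ a ∸ b
    eq a zero    = refl
    eq a (suc b) = trans (cong pred (eq a b)) (pred[m∸n]≡m∸[1+n] a b)

  -- The existence proof makes unbounded search total. The least zero is returned because `e-mu`
  -- asks for positive values below the result.
  search-c : ∀ {n} (F : I → Vec ℕ (suc n) → ℕ) → Comp o F →
             (∀ i v → Σ ℕ λ u → F i (u ∷ v) ≡ 0) →
             Σ (I → Vec ℕ n → ℕ) λ M → Comp o M × (∀ i v → F i (M i v ∷ v) ≡ 0)
  search-c F (c , h) ex =
    (λ i v → proj₁ (l i v)) ,
    (mu c , λ i v → e-mu (subst (Eval (o i) c _) (proj₁ (proj₂ (l i v))) (h i _)) (λ z z<m →
       pred (F i (z ∷ v)) ,
       subst (Eval (o i) c _) (pos (proj₂ (proj₂ (l i v)) z z<m)) (h i (z ∷ v)))) ,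
    λ i v → proj₁ (proj₂ (l i v))
    where
    l : ∀ i v → Σ ℕ λ m → F i (m ∷ v) ≡ 0 × (∀ z → z < m → F i (z ∷ v) ≢ 0)
    l i v = least-zero (λ u → F i (u ∷ v)) (proj₁ (ex i v)) (proj₂ (ex i v))
    pos : ∀ {k} → k ≢ 0 → k ≡ suc (pred k)
    pos {zero} k≢0  = ⊥-elim (k≢0 refl)
    pos {suc k} k≢0 = refl

-- Equality testing, pairing and coding of finite strings.

dist : ℕ → ℕ → ℕ
dist a b = (a ∸ b) + (b ∸ a)

dist-refl : ∀ a → dist a a ≡ 0
dist-refl a rewrite n∸n≡0 a = refl

dist≡0 : ∀ a b → dist a b ≡ 0 → a ≡ b
dist≡0 a b d = ≤-antisym (m∸n≡0⇒m≤n (m+n≡0⇒m≡0 (a ∸ b) d)) (m∸n≡0⇒m≤n (m+n≡0⇒n≡0 (a ∸ b) d))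

dist-c : ∀ {I : Set} {o : I → Baire} {n} {F G : I → Vec ℕ n → ℕ} → Comp o F → Comp o G →
         Comp o (λ i v → dist (F i v) (G i v))
dist-c f g = add-c (monus-c f g) (monus-c g f)

ifz-≢ : ∀ {z a b} → z ≢ 0 → ifz z a b ≡ b
ifz-≢ {zero} z≢0  = ⊥-elim (z≢0 refl)
ifz-≢ {suc z} z≢0 = refl

abstract
  -- Cantor pairing: the inverse reads off the index of the diagonal containing t by recursion on t.
  tri : ℕ → ℕ
  tri = natrec 0 (λ k r → suc k + r)

  diag : ℕ → ℕ
  diag = natrec 0 (λ t r → ifz (dist (tri (suc r)) (suc t)) (suc r) r)

  pair : ℕ → ℕ → ℕ
  pair a b = tri (a + b) + a

  π₁ π₂ : ℕ → ℕ
  π₁ t = t ∸ tri (diag t)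
  π₂ t = diag t ∸ π₁ t

  -- Diagonal `n` consists of the numbers `tri n + k` with `k ≤ n`. The recursion increases its
  -- value only on reaching the next triangular number, which for `k ≤ n` has not happened yet.
  diag-tri : ∀ n k → k ≤ n → diag (tri n + k) ≡ n
  diag-tri zero zero k≤n = refl
  diag-tri (suc m) zero k≤n
    rewrite +-identityʳ (m + tri m) | +-comm m (tri m) | diag-tri m m ≤-refl
          | +-comm m (tri m) | dist-refl (tri m + m) = refl
  diag-tri n (suc j) k≤n
    rewrite +-suc (tri n) j | diag-tri n j (<⇒≤ k≤n) =
    ifz-≢ λ d → <⇒≢ k≤n (sym (+-cancelʳ-≡ (tri n) n j
      (trans (suc-injective (dist≡0 _ _ d)) (+-comm (tri n) j))))

  π₁-pair : ∀ a b → π₁ (pair a b) ≡ a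
  π₁-pair a b rewrite diag-tri (a + b) a (m≤m+n a b) = m+n∸m≡n (tri (a + b)) a

  π₂-pair : ∀ a b → π₂ (pair a b) ≡ b
  π₂-pair a b rewrite π₁-pair a b | diag-tri (a + b) a (m≤m+n a b) = m+n∸m≡n a b

  ≤-pair : ∀ a b → a ≤ pair a b
  ≤-pair a b = m≤n+m a (tri (a + b))

  -- Every number is read as an infinite nested pair, so it has entries at all positions; the length
  -- of a finite list must be kept separately.
  entry : ℕ → ℕ → ℕ
  entry t i = π₁ (natrec t (λ _ r → π₂ r) i)

  entry-suc : ∀ a t i → entry (pair a t) (suc i) ≡ entry t i
  entry-suc a t i = cong π₁ (shift i)
    where
    shift : ∀ i → natrec (pair a t) (λ _ r → π₂ r) (suc i) ≡ natrec t (λ _ r → π₂ r) i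
    shift zero    = π₂-pair a t
    shift (suc i) = cong π₂ (shift i)

  entry-surjective : ∀ {n} (x : Fin n → ℕ) → Σ ℕ λ t → ∀ i → entry t (toℕ i) ≡ x i
  entry-surjective {zero} x = 0 , λ ()
  entry-surjective {suc n} x with entry-surjective (x ∘ suc)
  ... | t , h = pair (x zero) t , λ
    { zero → π₁-pair (x zero) t
    ; (suc i) → trans (entry-suc (x zero) t (toℕ i)) (h i) }

  -- A number u codes the finite string of length π₁ u with entries listed by π₂ u;
  -- partial values are shifted by one, 0 meaning undefined.
  string : ℕ → ℕ → ℕ
  string u i = ifz (π₁ u ∸ i) 0 (suc (entry (π₂ u) i))

  -- The bound `N ≤ u` lets one number `u` act both as a string and as the clock of a computation
  -- using that string.
  string-complete : ∀ (x : ℕ → ℕ) N → Σ ℕ λ u → N ≤ u × (∀ i → i < N → string u i ≡ suc (x i))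
  string-complete x N with entry-surjective {N} (x ∘ toℕ)
  ... | t , h = pair N t , ≤-pair N t , agree
    where
    agree : ∀ i → i < N → string (pair N t) i ≡ suc (x i)
    agree i i<N = trans
      (cong₂ (λ ℓ s → ifz (ℓ ∸ i) 0 (suc (entry s i))) (π₁-pair N t) (π₂-pair N t))
      (trans (ifz-≢ (m>n⇒m∸n≢0 i<N))
        (cong suc (subst (λ j → entry t j ≡ x j) (toℕ-fromℕ< i<N) (h (fromℕ< i<N)))))

  string-finite : ∀ u i → π₁ u ≤ i → string u i ≡ 0
  string-finite u i ℓ≤i rewrite m≤n⇒m∸n≡0 ℓ≤i = refl

  tri-c : ∀ {I : Set} {o : I → Baire} {n} {F : I → Vec ℕ n → ℕ} →
          Comp o F → Comp o (λ i v → tri (F i v))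
  tri-c f = rec-c (λ i w → suc (lookup w zero) + lookup w (suc zero)) (const-c 0)
              (add-c (suc-c (var zero)) (var (suc zero))) f

  diag-c : ∀ {I : Set} {o : I → Baire} {n} {F : I → Vec ℕ n → ℕ} →
           Comp o F → Comp o (λ i v → diag (F i v))
  diag-c f =
    rec-c (λ i w → ifz (dist (tri (suc (lookup w (suc zero)))) (suc (lookup w zero)))
                       (suc (lookup w (suc zero))) (lookup w (suc zero)))
      (const-c 0)
      (ifz-c (dist-c (tri-c (suc-c (var (suc zero)))) (suc-c (var zero)))
             (suc-c (var (suc zero))) (var (suc zero)))
      f

  pair-c : ∀ {I : Set} {o : I → Baire} {n} {F G : I → Vec ℕ n → ℕ} →
           Comp o F → Comp o G → Comp o (λ i v → pair (F i v) (G i v))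
  pair-c f g = add-c (tri-c (add-c f g)) f

  π₁-c : ∀ {I : Set} {o : I → Baire} {n} {F : I → Vec ℕ n → ℕ} →
         Comp o F → Comp o (λ i v → π₁ (F i v))
  π₁-c f = monus-c f (tri-c (diag-c f))

  π₂-c : ∀ {I : Set} {o : I → Baire} {n} {F : I → Vec ℕ n → ℕ} →
         Comp o F → Comp o (λ i v → π₂ (F i v))
  π₂-c f = monus-c (diag-c f) (π₁-c f)

  entry-c : ∀ {I : Set} {o : I → Baire} {n} {F G : I → Vec ℕ n → ℕ} →
            Comp o F → Comp o G →
            Comp o (λ i v → entry (F i v) (G i v))
  entry-c f g = π₁-c (rec-c (λ i w → π₂ (lookup w (suc zero))) f (π₂-c (var (suc zero))) g)

  string-c : ∀ {I : Set} {o : I → Baire} {n} {F G : I → Vec ℕ n → ℕ} →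
             Comp o F → Comp o G → Comp o (λ i v → string (F i v) (G i v))
  string-c f g = ifz-c (monus-c (π₁-c f) g) (const-c 0) (suc-c (entry-c (π₂-c f) g))

-- Evaluation with finitely much information

-- Clocked evaluation with a partial oracle; outputs are shifted by one, 0 meaning "no value yet".
allDefined : ∀ {m} → (Fin m → ℕ) → ℕ
allDefined {zero}  v = 1
allDefined {suc m} v = ifz (v zero) 0 (allDefined (v ∘ suc))

-- State 0: undefined value met; 1: still searching; y + 2: zero found at y.
muStep : (ℕ → ℕ) → ℕ → ℕ → ℕ
muStep F k st =
  ifz st 0 (ifz (pred st) (ifz (F k) 0 (ifz (pred (F k)) (suc (suc k)) 1)) st)

muState : (ℕ → ℕ) → ℕ → ℕ
muState F = natrec 1 (muStep F)

-- Only the `mu` clause limits its work by the clock `s`; the other clauses recurse on the code and,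
-- for `prec`, on the argument.
ev : ∀ {n} → ℕ → (ℕ → ℕ) → Code n → Vec ℕ n → ℕ
ev s p zer xs = 1
ev s p sucᶜ (x ∷ []) = suc (suc x)
ev s p (proj i) xs = suc (lookup xs i)
ev s p orc (x ∷ []) = p x
ev s p (comp g hs) xs =
  ifz (allDefined (λ j → ev s p (hs j) xs)) 0
      (ev s p g (tabulate (λ j → pred (ev s p (hs j) xs))))
ev s p (prec g h) (k ∷ xs) =
  natrec (ev s p g xs) (λ j r → ifz r 0 (ev s p h (j ∷ pred r ∷ xs))) k
-- `pred` sends both states without a result to 0 and turns the state `y + 2` into the shifted value
-- `y + 1`.
ev s p (mu g) xs = pred (muState (λ z → ev s p g (z ∷ xs)) s)

Defined : ℕ → Set
Defined r = Σ ℕ λ v → r ≡ suc v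

defined-pred : ∀ {r} → Defined r → r ≡ suc (pred r)
defined-pred (v , refl) = refl

ifz-defined : ∀ {z b y} → ifz z 0 b ≡ suc y → Defined z × b ≡ suc y
ifz-defined {suc z} eq = (z , refl) , eq

allDefined-elim : ∀ {m} (v : Fin m → ℕ) → Defined (allDefined v) → ∀ j → Defined (v j)
allDefined-elim {suc m} v (_ , eq) j with ifz-defined {v zero} eq
allDefined-elim {suc m} v (_ , eq) zero    | d , _    = d
allDefined-elim {suc m} v (_ , eq) (suc j) | _ , eq′ = allDefined-elim (v ∘ suc) (_ , eq′) j

allDefined-intro : ∀ {m} (v : Fin m → ℕ) → (∀ j → Defined (v j)) → Defined (allDefined v)
allDefined-intro {zero} v d = 0 , refl
allDefined-intro {suc m} v d with v zero | d zero
... | .(suc w) | w , refl = allDefined-intro (v ∘ suc) (d ∘ suc)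

-- Because of the shift, `suc (suc v)` stands for the positive value `suc v`, and 1 for the value 0
-- that ends a search.
PositiveBelow : (ℕ → ℕ) → ℕ → Set
PositiveBelow F k = ∀ z → z < k → Σ ℕ λ v → F z ≡ suc (suc v)

MuInvariant : (ℕ → ℕ) → ℕ → ℕ → Set
MuInvariant F k st =
  st ≡ 0 ⊎ (st ≡ 1 × PositiveBelow F k) ⊎
  Σ ℕ λ y → st ≡ suc (suc y) × F y ≡ 1 × PositiveBelow F y

below-suc : ∀ {F k v} → PositiveBelow F k → F k ≡ suc (suc v) → PositiveBelow F (suc k)
below-suc {F} {k} b eq z z<1+k with m≤n⇒m<n∨m≡n (≤-pred z<1+k)
... | inj₁ z<k  = b z z<k
... | inj₂ refl = _ , eq

muState-invariant : ∀ F k → MuInvariant F k (muState F k)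
muState-invariant F zero = inj₂ (inj₁ (refl , λ z ()))
muState-invariant F (suc k) with muState F k | muState-invariant F k
... | .0 | inj₁ refl = inj₁ refl
... | .(suc (suc y)) | inj₂ (inj₂ (y , refl , r)) = inj₂ (inj₂ (y , refl , r))
... | .1 | inj₂ (inj₁ (refl , b)) with F k in eq
...   | 0           = inj₁ refl
...   | 1           = inj₂ (inj₂ (k , refl , eq , b))
...   | suc (suc v) = inj₂ (inj₁ (refl , below-suc b eq))

muState-searching : ∀ F k → PositiveBelow F k → muState F k ≡ 1
muState-searching F zero b = refl
muState-searching F (suc k) b
  rewrite muState-searching F k (λ z z<k → b z (m<n⇒m<1+n z<k)) | proj₂ (b k (n<1+n k)) = refl

muState-found : ∀ F y → F y ≡ 1 → PositiveBelow F y → ∀ k → y < k → muState F k ≡ suc (suc y)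
muState-found F y Fy b (suc k) y<1+k with m≤n⇒m<n∨m≡n (≤-pred y<1+k)
... | inj₂ refl rewrite muState-searching F k b | Fy = refl
... | inj₁ y<k rewrite muState-found F y Fy b k y<k = refl

module _ {f : Baire} {s : ℕ} {p : ℕ → ℕ} (p⊑f : ∀ i v → p i ≡ suc v → f i ≡ v) where

  ev-sound : ∀ {n} (c : Code n) xs {y} → ev s p c xs ≡ suc y → Eval f c xs y
  ev-sound zer xs refl = e-zer
  ev-sound sucᶜ (x ∷ []) refl = e-suc
  ev-sound (proj i) xs refl = e-proj
  ev-sound orc (x ∷ []) eq = subst (Eval f orc (x ∷ [])) (p⊑f x _ eq) e-orc
  ev-sound (comp g hs) xs eq with ifz-defined {allDefined (λ j → ev s p (hs j) xs)} eq
  ... | d , eq′ =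
    e-comp (λ j → ev-sound (hs j) xs
             (trans (defined-pred (allDefined-elim _ d j)) (cong suc (sym (lookup∘tabulate _ j)))))
           (ev-sound g _ eq′)
  ev-sound (prec g h) (k ∷ xs) = run k
    where
    run : ∀ k {y} → ev s p (prec g h) (k ∷ xs) ≡ suc y → Eval f (prec g h) (k ∷ xs) y
    run zero eq = e-prec0 (ev-sound g xs eq)
    run (suc k) eq with ifz-defined {ev s p (prec g h) (k ∷ xs)} eq
    ... | d , eq′ = e-precS (run k (defined-pred d)) (ev-sound h _ eq′)
  ev-sound (mu g) xs eq
    with muState (λ z → ev s p g (z ∷ xs)) s | muState-invariant (λ z → ev s p g (z ∷ xs)) s
  ev-sound (mu g) xs () | .0 | inj₁ refl
  ev-sound (mu g) xs () | .1 | inj₂ (inj₁ (refl , b))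
  ev-sound (mu g) xs refl | ._ | inj₂ (inj₂ (y , refl , eq₀ , b)) =
    e-mu (ev-sound g (y ∷ xs) eq₀) λ z z<y → proj₁ (b z z<y) , ev-sound g (z ∷ xs) (proj₂ (b z z<y))

Agree : (ℕ → ℕ) → Baire → ℕ → Set
Agree p f N = ∀ i → i < N → p i ≡ suc (f i)

Agree-≤ : ∀ {p f M N} → M ≤ N → Agree p f N → Agree p f M
Agree-≤ M≤N a i i<M = a i (<-≤-trans i<M M≤N)

maximum : ∀ {m} → (Fin m → ℕ) → ℕ
maximum {zero}  N = 0
maximum {suc m} N = N zero ⊔ maximum (N ∘ suc)

≤-maximum : ∀ {m} (N : Fin m → ℕ) j → N j ≤ maximum N
≤-maximum N zero    = m≤m⊔n (N zero) _
≤-maximum N (suc j) = ≤-trans (≤-maximum (N ∘ suc) j) (m≤n⊔m (N zero) _)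

-- Quantifying over all later clocks and all sufficiently agreeing oracles makes the property
-- monotone in `N`, so bounds of several subcomputations combine by maximum.
Eventually : ∀ {n} → Baire → Code n → Vec ℕ n → ℕ → ℕ → Set
Eventually f c xs y N = ∀ s p → N ≤ s → Agree p f N → ev s p c xs ≡ suc y

Eventually-≤ : ∀ {f n} {c : Code n} {xs y M N} → M ≤ N → Eventually f c xs y M → Eventually f c xs y N
Eventually-≤ M≤N h s p N≤s a = h s p (≤-trans M≤N N≤s) (Agree-≤ M≤N a)

-- A derivation is a finite object: it asks finitely many oracle questions and contains finitely
-- many searches, so a maximum over its subderivations bounds both.
ev-complete : ∀ {f n} {c : Code n} {xs y} → Eval f c xs y → Σ ℕ (Eventually f c xs y)
ev-complete e-zer  = 0 , λ s p N≤s a → refl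
ev-complete e-suc  = 0 , λ s p N≤s a → refl
ev-complete e-proj = 0 , λ s p N≤s a → refl
ev-complete (e-orc {x}) = suc x , λ s p N≤s a → a x (n<1+n x)
ev-complete {f} (e-comp {g = g} {hs} {xs} {ys} {y} ds d) = N ⊔ Nd , run
  where
  N  = maximum (λ j → proj₁ (ev-complete (ds j)))
  Nd = proj₁ (ev-complete d)
  run : Eventually f (comp g hs) xs y (N ⊔ Nd)
  run s p N≤s a =
    trans (ifz-≢ λ z → 1+n≢0 (trans (sym (proj₂ all)) z))
      (trans (cong (ev s p g) (trans (tabulate-cong (λ j → cong pred (val j))) (tabulate∘lookup ys)))
             (Eventually-≤ {c = g} (m≤n⊔m N Nd) (proj₂ (ev-complete d)) s p N≤s a))
    where
    val : ∀ j → ev s p (hs j) xs ≡ suc (lookup ys j)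
    val j = Eventually-≤ {c = hs j} (≤-trans (≤-maximum (λ j → proj₁ (ev-complete (ds j))) j) (m≤m⊔n N Nd))
              (proj₂ (ev-complete (ds j))) s p N≤s a
    all = allDefined-intro (λ j → ev s p (hs j) xs) (λ j → _ , val j)
ev-complete (e-prec0 d) = proj₁ (ev-complete d) , proj₂ (ev-complete d)
ev-complete {f} (e-precS {g = g} {h} {k} {xs} {y} {z} d d′) =
  N ⊔ N′ , λ s p N≤s a →
    trans (cong (λ r → ifz r 0 (ev s p h (k ∷ pred r ∷ xs)))
             (Eventually-≤ {c = prec g h} {k ∷ xs} (m≤m⊔n N N′) (proj₂ (ev-complete d)) s p N≤s a))
          (Eventually-≤ {c = h} (m≤n⊔m N N′) (proj₂ (ev-complete d′)) s p N≤s a)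
  where
  N  = proj₁ (ev-complete d)
  N′ = proj₁ (ev-complete d′)
ev-complete {f} (e-mu {g = g} {xs} {y} d ds) = B , run
  where
  N  = proj₁ (ev-complete d)
  below : ∀ z (z<y : z < y) → Σ ℕ (Eventually f g (z ∷ xs) (suc (proj₁ (ds z z<y))))
  below z z<y = ev-complete (proj₂ (ds z z<y))
  M : Fin y → ℕ
  M j = proj₁ (below (toℕ j) (toℕ<n j))
  -- `suc y` keeps the clocked search running until it has tested `y`.
  B = (suc y ⊔ N) ⊔ maximum M
  run : Eventually f (mu g) xs y B
  run s p B≤s a =
    cong pred (muState-found (λ z → ev s p g (z ∷ xs)) y
      (Eventually-≤ {c = g} (≤-trans (m≤n⊔m (suc y) N) (m≤m⊔n _ (maximum M)))
        (proj₂ (ev-complete d)) s p B≤s a)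
      (λ z z<y → subst (λ z → Σ ℕ λ v → ev s p g (z ∷ xs) ≡ suc (suc v)) (toℕ-fromℕ< z<y)
        (_ , Eventually-≤ {c = g} (≤-trans (≤-maximum M (fromℕ< z<y)) (m≤n⊔m (suc y ⊔ N) _))
          (proj₂ (below _ (toℕ<n (fromℕ< z<y)))) s p B≤s a))
      s (≤-trans (m≤m⊔n (suc y) N) (≤-trans (m≤m⊔n _ (maximum M)) B≤s)))

-- Both values are read off the same run of the function `ev`, at a clock beyond both bounds.
Eval-deterministic : ∀ {f n} {c : Code n} {xs y z} → Eval f c xs y → Eval f c xs z → y ≡ z
Eval-deterministic {f} {c = c} d e =
  suc-injective (trans (sym (eventual d (m≤m⊔n N M))) (eventual e (m≤n⊔m N M)))
  where
  N = proj₁ (ev-complete d)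
  M = proj₁ (ev-complete e)
  eventual : ∀ {y} (d : Eval f c _ y) → proj₁ (ev-complete d) ≤ N ⊔ M →
       ev (N ⊔ M) (suc ∘ f) c _ ≡ suc y
  eventual d N≤ = proj₂ (ev-complete d) (N ⊔ M) (suc ∘ f) N≤ (λ i i<N → refl)

-- The use principle: the clocked run with `g` as oracle already gives the value once `g` agrees
-- with `f` below the bound, and soundness turns this run into a derivation.
Eval-use : ∀ {f n} {c : Code n} {xs y} → Eval f c xs y →
           Σ ℕ λ N → ∀ g → (∀ i → i < N → g i ≡ f i) → Eval g c xs y
Eval-use {f} {c = c} d with ev-complete d
... | N , h = N , λ g g≈f → ev-sound (λ i v → suc-injective) c _
                    (h N (suc ∘ g) ≤-refl (λ i i<N → cong suc (g≈f i i<N)))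

Eval-≗ : ∀ {f g n} {c : Code n} {xs y} → (∀ i → g i ≡ f i) → Eval f c xs y → Eval g c xs y
Eval-≗ g≗f d = proj₂ (Eval-use d) _ (λ i _ → g≗f i)

-- Computability of clocked evaluation.

allDefined-c : ∀ {m} {I : Set} {o : I → Baire} {n} (v : Fin m → I → Vec ℕ n → ℕ) →
               (∀ j → Comp o (v j)) → Comp o (λ i xs → allDefined (λ j → v j i xs))
allDefined-c {zero}  v c = const-c 1
allDefined-c {suc m} v c = ifz-c (c zero) (const-c 0) (allDefined-c (v ∘ suc) (c ∘ suc))

module _ {I : Set} {o : I → Baire} (p : I → ℕ → ℕ → ℕ)
         (p-c : Comp o {2} (λ i w → p i (lookup w zero) (lookup w (suc zero)))) where

  -- The first argument is at once the clock and the index of the partial oracle, so one unbounded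
  -- search ranges over both.
  ev-c : ∀ {n} (c : Code n) →
         Comp o {suc n} (λ i w → ev (lookup w zero) (p i (lookup w zero)) c (tail w))
  ev-c zer = const-c 1
  ev-c sucᶜ = comp-ext (λ { i (u ∷ x ∷ []) → refl }) (suc-c (suc-c (var (suc zero))))
  ev-c (proj j) = suc-c (CompV.at drop₁ j)
  ev-c orc = comp-ext (λ { i (u ∷ x ∷ []) → refl }) p-c
  ev-c (comp {m} {n} g hs) =
    ifz-c (allDefined-c (λ j i w → ev (lookup w zero) (p i (lookup w zero)) (hs j) (tail w))
                        (λ j → ev-c (hs j)))
          (const-c 0)
          (ev-c g ⟦ var zero ◂ args ⟧)
    where
    args : CompV o (λ i w → tabulate (λ j → pred (ev (lookup w zero) (p i (lookup w zero)) (hs j) (tail w))))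
    args = components λ j → comp-ext (λ i w → sym (lookup∘tabulate _ j)) (pred-c (ev-c (hs j)))
  ev-c (prec g h) =
    comp-ext (λ { i (u ∷ k ∷ xs) → refl })
      -- Here `w` lists the counter, the previous value, `u`, the recursion argument and then the
      -- parameters.
      (rec-c (λ i w → let u = lookup w (suc (suc zero)) in
                      ifz (lookup w (suc zero)) 0
                        (ev u (p i u) h (lookup w zero ∷ pred (lookup w (suc zero)) ∷ tail (tail (tail (tail w))))))
        (ev-c g ⟦ var zero ◂ drop₂ ⟧)
        (ifz-c (var (suc zero)) (const-c 0)
          (ev-c h ⟦ var (suc (suc zero)) ◂ var zero ◂ pred-c (var (suc zero)) ◂ drops₄ ⟧))
        (var (suc zero)))
    where
    drops₄ : ∀ {n} → CompV o {suc (suc (suc (suc n)))} (λ i w → tail (tail (tail (tail w))))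
    drops₄ = components λ j → proj (suc (suc (suc (suc j)))) , λ { i (_ ∷ _ ∷ _ ∷ _ ∷ xs) → e-proj }
  ev-c (mu g) =
    pred-c (rec-c (λ i w → let u = lookup w (suc (suc zero)) in
                           muStep (λ z → ev u (p i u) g (z ∷ tail (tail (tail w))))
                                  (lookup w zero) (lookup w (suc zero)))
             (const-c 1)
             (ifz-c (var (suc zero)) (const-c 0)
               (ifz-c (pred-c (var (suc zero)))
                 (ifz-c value (const-c 0) (ifz-c (pred-c value) (suc-c (suc-c (var zero))) (const-c 1)))
                 (var (suc zero))))
             (var zero))
    where
    drops₃ : ∀ {n} → CompV o {suc (suc (suc n))} (λ i w → tail (tail (tail w)))
    drops₃ = components λ j → proj (suc (suc (suc j))) , λ { i (_ ∷ _ ∷ _ ∷ xs) → e-proj }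
    value = ev-c g ⟦ var (suc (suc zero)) ◂ var zero ◂ drops₃ ⟧

-- Enumeration of codes

-- This replaces equality of codes: `comp` contains a function on `Fin m`, which decoding recovers
-- only component by component.
_⊑_ : ∀ {n} → Code n → Code n → Set
c ⊑ d = ∀ {f xs y} → Eval f c xs y → Eval f d xs y

comp-⊑ : ∀ {m n} {g g′ : Code m} {hs hs′ : Fin m → Code n} →
         g ⊑ g′ → (∀ j → hs j ⊑ hs′ j) → comp g hs ⊑ comp g′ hs′
comp-⊑ g⊑ hs⊑ (e-comp ds d) = e-comp (λ j → hs⊑ j (ds j)) (g⊑ d)

prec-⊑ : ∀ {n} {g g′ : Code n} {h h′ : Code (suc (suc n))} →
         g ⊑ g′ → h ⊑ h′ → prec g h ⊑ prec g′ h′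
prec-⊑ g⊑ h⊑ (e-prec0 d)    = e-prec0 (g⊑ d)
prec-⊑ g⊑ h⊑ (e-precS d d′) = e-precS (prec-⊑ g⊑ h⊑ d) (h⊑ d′)

mu-⊑ : ∀ {n} {g g′ : Code (suc n)} → g ⊑ g′ → mu g ⊑ mu g′
mu-⊑ g⊑ (e-mu d ds) = e-mu (g⊑ d) (λ z z<y → proj₁ (ds z z<y) , g⊑ (proj₂ (ds z z<y)))

-- `fuel` bounds the depth of the decoded code and so makes decoding total; ill-formed numbers yield
-- `zer`.
decode     : ℕ → ∀ n → ℕ → Code n
decodeNode : ℕ → ∀ n → ℕ → ℕ → Code n
decodeComp : ℕ → ∀ n → ℕ → ℕ → ℕ → Code n
decodePrec : ℕ → ∀ n → ℕ → ℕ → Code n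
decodeProj : ∀ n → ℕ → Code n

decode zero       n t = zer
decode (suc fuel) n t = decodeNode fuel n (π₁ t) (π₂ t)

decodeNode fuel 1 0 a = sucᶜ
decodeNode fuel 1 1 a = orc
decodeNode fuel n 2 a = decodeProj n a
decodeNode fuel n 3 a = decodeComp fuel n (π₁ a) (π₁ (π₂ a)) (π₂ (π₂ a))
decodeNode fuel n 4 a = decodePrec fuel n (π₁ a) (π₂ a)
decodeNode fuel n 5 a = mu (decode fuel (suc n) a)
decodeNode fuel n _ a = zer

decodeComp fuel n m a b = comp (decode fuel m a) (λ i → decode fuel n (entry b (toℕ i)))

decodePrec fuel zero    a b = zer
decodePrec fuel (suc n) a b = prec (decode fuel n a) (decode fuel (suc (suc n)) b)

decodeProj n a with a <? n
... | yes a<n = proj (fromℕ< a<n)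
... | no  _   = zer

decodeProj-toℕ : ∀ {n} (i : Fin n) → decodeProj n (toℕ i) ≡ proj i
decodeProj-toℕ {n} i with toℕ i <? n
... | yes p = cong proj (fromℕ<-toℕ i p)
... | no ¬p = ⊥-elim (¬p (toℕ<n i))

decode-pair : ∀ {fuel n c} k a → c ⊑ decodeNode fuel n k a → c ⊑ decode (suc fuel) n (pair k a)
decode-pair {fuel} {n} {c} k a =
  subst (c ⊑_) (sym (cong₂ (decodeNode fuel n) (π₁-pair k a) (π₂-pair k a)))

-- Holding for all sufficiently large fuel lets the subcodes of a code share the same fuel.
decode-complete : ∀ {n} (c : Code n) →
                  Σ ℕ λ F → ∀ fuel → F ≤ fuel → Σ ℕ λ t → c ⊑ decode fuel n t
-- The tag 6 has no clause of its own in `decodeNode` and falls to the default `zer`.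
decode-complete zer = 1 , λ { (suc fuel) _ → pair 6 0 , decode-pair 6 0 (λ { e-zer → zer-eval }) }
  where
  zer-eval : ∀ {fuel n f xs} → Eval f (decodeNode fuel n 6 0) xs 0
  zer-eval {n = zero}        = e-zer
  zer-eval {n = suc zero}    = e-zer
  zer-eval {n = suc (suc n)} = e-zer
decode-complete sucᶜ = 1 , λ { (suc fuel) _ → pair 0 0 , decode-pair 0 0 id }
decode-complete orc  = 1 , λ { (suc fuel) _ → pair 1 0 , decode-pair 1 0 id }
decode-complete {n} (proj i) = 1 , λ { (suc fuel) _ →
  pair 2 (toℕ i) , decode-pair 2 (toℕ i)
    (subst (proj i ⊑_) (trans (sym (decodeProj-toℕ i)) (node n)) id) }
  where
  node : ∀ {fuel} n {a} → decodeProj n a ≡ decodeNode fuel n 2 a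
  node zero          = refl
  node (suc zero)    = refl
  node (suc (suc n)) = refl
decode-complete {n} (comp {m} g hs) = suc (F₀ ⊔ maximum F) , find
  where
  F₀ = proj₁ (decode-complete g)
  F  = λ j → proj₁ (decode-complete (hs j))
  node : ∀ {fuel} n {m a b} →
         decodeComp fuel n m a b ≡ decodeNode fuel n 3 (pair m (pair a b))
  node {fuel} n {m} {a} {b} =
    trans (sym (trans (cong₂ (λ x y → decodeComp fuel n x (π₁ y) (π₂ y))
                        (π₁-pair m (pair a b)) (π₂-pair m (pair a b)))
                      (cong₂ (decodeComp fuel n m) (π₁-pair a b) (π₂-pair a b))))
          (unfold n)
    where
    unfold : ∀ n {a} → decodeComp fuel n (π₁ a) (π₁ (π₂ a)) (π₂ (π₂ a)) ≡ decodeNode fuel n 3 a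
    unfold zero          = refl
    unfold (suc zero)    = refl
    unfold (suc (suc n)) = refl
  find : ∀ fuel → suc (F₀ ⊔ maximum F) ≤ fuel → Σ ℕ λ t → comp g hs ⊑ decode fuel n t
  find (suc fuel) (s≤s F≤)
    with proj₂ (decode-complete g) fuel (≤-trans (m≤m⊔n F₀ (maximum F)) F≤)
       | (λ j → proj₂ (decode-complete (hs j)) fuel
                  (≤-trans (≤-maximum F j) (≤-trans (m≤n⊔m F₀ (maximum F)) F≤)))
  ... | a , g⊑ | ts with entry-surjective (λ j → proj₁ (ts j))
  ...   | b , eq = pair 3 (pair m (pair a b)) , decode-pair 3 _
          (subst (comp g hs ⊑_) (node n)
            (comp-⊑ g⊑ (λ j → subst (λ t → hs j ⊑ decode fuel n t) (sym (eq j)) (proj₂ (ts j)))))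
decode-complete (prec {n} g h) = suc (F₀ ⊔ F₁) , find
  where
  F₀ = proj₁ (decode-complete g)
  F₁ = proj₁ (decode-complete h)
  unfold : ∀ {fuel} n {a} → decodePrec fuel (suc n) (π₁ a) (π₂ a) ≡ decodeNode fuel (suc n) 4 a
  unfold zero    = refl
  unfold (suc n) = refl
  find : ∀ fuel → suc (F₀ ⊔ F₁) ≤ fuel → Σ ℕ λ t → prec g h ⊑ decode fuel (suc n) t
  find (suc fuel) (s≤s F≤)
    with proj₂ (decode-complete g) fuel (≤-trans (m≤m⊔n F₀ F₁) F≤)
       | proj₂ (decode-complete h) fuel (≤-trans (m≤n⊔m F₀ F₁) F≤)
  ... | a , g⊑ | b , h⊑ = pair 4 (pair a b) , decode-pair 4 _
        (subst (prec g h ⊑_)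
          (trans (cong₂ (decodePrec fuel (suc n)) (sym (π₁-pair a b)) (sym (π₂-pair a b))) (unfold n))
          (prec-⊑ g⊑ h⊑))
decode-complete {n} (mu g) = suc (proj₁ (decode-complete g)) , λ { (suc fuel) (s≤s F≤) →
  let (t , g⊑) = proj₂ (decode-complete g) fuel F≤ in
  pair 5 t , decode-pair 5 t (subst (mu g ⊑_) (unfold n) (mu-⊑ g⊑)) }
  where
  unfold : ∀ {fuel} n {t} → mu (decode fuel (suc n) t) ≡ decodeNode fuel n 5 t
  unfold zero          = refl
  unfold (suc zero)    = refl
  unfold (suc (suc n)) = refl

code : ℕ → Code 1
code t = decode (π₁ t) 1 (π₂ t)

code-complete : ∀ c → Σ ℕ λ t → c ⊑ code t
code-complete c with decode-complete c
... | F , h with h F ≤-refl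
...   | t , c⊑ = pair F t ,
        subst (c ⊑_) (sym (cong₂ (λ a b → decode a 1 b) (π₁-pair F t) (π₂-pair F t))) c⊑

-- Reducibilities

relativize : ∀ {n} → Code 1 → Code n → Code n
relativize d zer         = zer
relativize d sucᶜ        = sucᶜ
relativize d (proj i)    = proj i
relativize d orc         = d
relativize d (comp g hs) = comp (relativize d g) (λ j → relativize d (hs j))
relativize d (prec g h)  = prec (relativize d g) (relativize d h)
relativize d (mu g)      = mu (relativize d g)

relativize-eval : ∀ {d f g n} {c : Code n} {xs y} →
                  d ⟨ f ⟩≃ g → Eval g c xs y → Eval f (relativize d c) xs y
relativize-eval r e-zer           = e-zer
relativize-eval r e-suc           = e-suc
relativize-eval r e-proj          = e-proj
relativize-eval r (e-orc {x})     = r x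
relativize-eval r (e-comp ds d)   = e-comp (λ j → relativize-eval r (ds j)) (relativize-eval r d)
relativize-eval r (e-prec0 d)     = e-prec0 (relativize-eval r d)
relativize-eval r (e-precS d d′)  = e-precS (relativize-eval r d) (relativize-eval r d′)
relativize-eval r (e-mu d ds)     =
  e-mu (relativize-eval r d) (λ z z<y → proj₁ (ds z z<y) , relativize-eval r (proj₂ (ds z z<y)))

Comp₁ : {I : Set} → (I → Baire) → (I → Baire) → Set
Comp₁ o x = Comp o {1} (λ i v → x i (lookup v zero))

module _ {I : Set} {o : I → Baire} where

  functional : {x : I → Baire} (e : Code 1) → (∀ i → e ⟨ o i ⟩≃ x i) → Comp₁ o x
  functional e h = e , λ { i (n ∷ []) → h i n }

  app : ∀ {n} {x : I → Baire} {F : I → Vec ℕ n → ℕ} →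
        Comp₁ o x → Comp o F → Comp o (λ i v → x i (F i v))
  app x-c f = x-c ⟦ f ◂ nil ⟧

_≤T_ : Baire → Baire → Set
x ≤T y = Σ (Code 1) λ e → e ⟨ y ⟩≃ x

≤T-Comp₁ : ∀ {I : Set} {x y} → x ≤T y → Comp₁ {I} (λ _ → y) (λ _ → x)
≤T-Comp₁ (e , h) = functional e (λ _ → h)

Comp₁-≤T : ∀ {x y} → Comp₁ {ℕ} (λ _ → y) (λ _ → x) → x ≤T y
Comp₁-≤T (c , h) = c , λ n → h 0 (n ∷ [])

≤T-trans : ∀ {x y z} → x ≤T y → y ≤T z → x ≤T z
≤T-trans (e , h) (d , r) = relativize d e , λ n → relativize-eval r (h n)

≤M-intro : ∀ {P Q : MassProblem} (x : Σ Baire P → Baire) →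
           Comp₁ proj₁ x → (∀ i → Q (x i)) → Q ≤M P
≤M-intro x (c , h) q = c , λ f p → x (f , p) , (λ n → h (f , p) (n ∷ [])) , q (f , p)

≤M-refl : ∀ {P} → P ≤M P
≤M-refl = orc , λ f p → f , (λ n → e-orc) , p

≤M-trans : ∀ {P Q R} → P ≤M Q → Q ≤M R → P ≤M R
≤M-trans (e , h) (d , r) = relativize d e , λ f Rf →
  let (g , dg , Qg) = r f Rf ; (k , ek , Pk) = h g Qg in
  k , (λ n → relativize-eval dg (ek n)) , Pk

⊆⇒≤M : ∀ {P Q : MassProblem} → (∀ f → P f → Q f) → Q ≤M P
⊆⇒≤M P⊆Q = orc , λ f p → f , (λ n → e-orc) , P⊆Q f p

cons : ℕ → Baire → Baire
cons m f zero    = m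
cons m f (suc n) = f n

module _ {I : Set} {o : I → Baire} where

  cons-c : ∀ m {x : I → Baire} → Comp₁ o x → Comp₁ o (λ i → cons m (x i))
  cons-c m {x} x-c =
    comp-ext (λ { i (zero ∷ []) → refl ; i (suc n ∷ []) → refl })
      (rec-c (λ i w → x i (lookup w zero)) (const-c m) (app {x = x} x-c (var zero)) (var zero))

  shift-c : {x : I → Baire} → Comp₁ o x → Comp₁ o (λ i n → x i (suc n))
  shift-c {x} x-c = app {x = x} x-c (suc-c (var zero))

oracle₁ : ∀ {I : Set} {o : I → Baire} → Comp₁ o o
oracle₁ = oracle (var zero)

-- Composition is strict; prec gives a lazy conditional, since its step code is not run at 0.
guard : Code 1 → Code 2
guard e = prec zer (comp e (λ _ → proj (suc (suc zero))))

guard-off : ∀ {f e n} → Eval f (guard e) (0 ∷ n ∷ []) 0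
guard-off = e-prec0 e-zer

guard-on : ∀ {f e n y} → Eval f e (n ∷ []) y → Eval f (guard e) (1 ∷ n ∷ []) y
guard-on {n = n} d = e-precS (e-prec0 e-zer) (e-comp {ys = n ∷ []} (λ { zero → e-proj }) d)

-- One functional reads `y a`, runs only the reduction for the case that holds and adds the two
-- outputs. The guard makes the other summand 0, even where its reduction diverges.
branch : ∀ {B Q : MassProblem} a v →
         B ≤M (λ y → Q y × y a ≡ v) → B ≤M (λ y → Q y × y a ≢ v) → B ≤M Q
branch {B} {Q} a v (e₁ , h₁) (e₂ , h₂) = proj₁ sum-c ⟪ gated e₁ on-eq , gated e₂ on-≢ ⟫ , run
  where
  _⟪_,_⟫ : ∀ {n} → Code 2 → Code n → Code n → Code n
  c ⟪ d₁ , d₂ ⟫ = comp c (λ { zero → d₁ ; (suc zero) → d₂ })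
  eval₂ : ∀ {f n c} {d₁ d₂ : Code n} {xs y₁ y₂ z} → Eval f d₁ xs y₁ → Eval f d₂ xs y₂ →
          Eval f c (y₁ ∷ y₂ ∷ []) z → Eval f (c ⟪ d₁ , d₂ ⟫) xs z
  eval₂ {y₁ = y₁} {y₂} e₁ e₂ = e-comp {ys = y₁ ∷ y₂ ∷ []} (λ { zero → e₁ ; (suc zero) → e₂ })
  sum-c : Comp id {2} (λ (f : Baire) w → lookup w zero + lookup w (suc zero))
  sum-c = add-c (var zero) (var (suc zero))
  on-eq : Comp id {1} (λ (f : Baire) w → ifz (dist (f a) v) 1 0)
  on-eq = ifz-c (dist-c (oracle (const-c a)) (const-c v)) (const-c 1) (const-c 0)
  on-≢ : Comp id {1} (λ (f : Baire) w → ifz (dist (f a) v) 0 1)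
  on-≢ = ifz-c (dist-c (oracle (const-c a)) (const-c v)) (const-c 0) (const-c 1)
  gated : Code 1 → {F : Baire → Vec ℕ 1 → ℕ} → Comp id F → Code 1
  gated e t = guard e ⟪ proj₁ t , proj zero ⟫
  off : ∀ {e F f n} (t : Comp id F) → F f (n ∷ []) ≡ 0 → Eval f (gated e t) (n ∷ []) 0
  off {f = f} (c , t) eq = eval₂ (subst (Eval f c _) eq (t f _)) e-proj guard-off
  on : ∀ {e F f n y} (t : Comp id F) → F f (n ∷ []) ≡ 1 → Eval f e (n ∷ []) y →
       Eval f (gated e t) (n ∷ []) y
  on {f = f} (c , t) eq d = eval₂ (subst (Eval f c _) eq (t f _)) e-proj (guard-on d)
  run : ∀ f → Q f →
        Σ Baire λ g → ((proj₁ sum-c ⟪ gated e₁ on-eq , gated e₂ on-≢ ⟫) ⟨ f ⟩≃ g) × B g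
  run f Qf with f a ≟ v
  ... | yes eq = let (g , eg , Bg) = h₁ f (Qf , eq)
                     d≡0 = trans (cong (λ b → dist b v) eq) (dist-refl v) in
        g , (λ n → subst (Eval f _ _) (+-identityʳ (g n))
              (eval₂ (on on-eq (cong (λ d → ifz d 1 0) d≡0) (eg n))
                     (off on-≢ (cong (λ d → ifz d 0 1) d≡0)) (proj₂ sum-c f _))) , Bg
  ... | no neq = let (g , eg , Bg) = h₂ f (Qf , neq)
                     d≢0 = λ d → neq (dist≡0 (f a) v d) in
        g , (λ n → eval₂ (off on-eq (ifz-≢ d≢0)) (on on-≢ (ifz-≢ d≢0) (eg n)) (proj₂ sum-c f _)) , Bg

-- The meet of Medvedev degrees: a member of either problem, preceded by a bit telling which.
_⊓_ : MassProblem → MassProblem → MassProblem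
(P ⊓ Q) y = (y 0 ≡ 0 × P (λ n → y (suc n))) ⊎ (y 0 ≡ 1 × Q (λ n → y (suc n)))

meet-lowerˡ : ∀ {P Q} → (P ⊓ Q) ≤M P
meet-lowerˡ {P} {Q} = ≤M-intro {P} {P ⊓ Q} (λ i → cons 0 (proj₁ i)) (cons-c 0 {proj₁} oracle₁)
  (λ i → inj₁ (refl , proj₂ i))

meet-lowerʳ : ∀ {P Q} → (P ⊓ Q) ≤M Q
meet-lowerʳ {P} {Q} = ≤M-intro {Q} {P ⊓ Q} (λ i → cons 1 (proj₁ i)) (cons-c 1 {proj₁} oracle₁)
  (λ i → inj₂ (refl , proj₂ i))

meet-greatest : ∀ {P Q R} → R ≤M P → R ≤M Q → R ≤M (P ⊓ Q)
meet-greatest {P} {Q} {R} R≤P R≤Q = branch 0 0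
  (≤M-trans R≤P (≤M-intro {Q = P} (λ i n → proj₁ i (suc n)) (shift-c {x = proj₁} oracle₁)
    (λ { (y , inj₁ (_ , Py) , _) → Py ; (y , inj₂ (y0≡1 , _) , y0≡0) → ⊥-elim (1+n≢0 (trans (sym y0≡1) y0≡0)) })))
  (≤M-trans R≤Q (≤M-intro {Q = Q} (λ i n → proj₁ i (suc n)) (shift-c {x = proj₁} oracle₁)
    (λ { (y , inj₁ (y0≡0 , _) , y0≢0) → ⊥-elim (y0≢0 y0≡0) ; (y , inj₂ (_ , Qy) , _) → Qy })))

-- The upward Turing closure of `B`. Inclusion of `P` in it is the nonuniform (Muchnik) form of
-- `B ≤M P`.
Cone : MassProblem → MassProblem
Cone B f = Σ Baire λ b → B b × b ≤T f

finite : List Baire → MassProblem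
finite L y = Any (λ z → ∀ n → y n ≡ z n) L

-- Evading problems

Hits : Code 1 → Baire → MassProblem → Set
Hits e f Q = Σ Baire λ g → (e ⟨ f ⟩≃ g) × Q g

-- Taking the tag m fresh keeps cons m f apart from the finitely many elements already excluded.
Evading : MassProblem → MassProblem → Set
Evading P B = ∀ L → All (λ z → P (z ∘ suc)) L → ∀ e m →
              Σ Baire λ f → P f × ¬ Hits e (cons m f) (B ⊓ finite L)

cons-code : ∀ m → Σ (Code 1) λ d → ∀ f → d ⟨ f ⟩≃ cons m f
cons-code m = proj₁ c , λ f n → proj₂ c f (n ∷ [])
  where
  c : Comp₁ {Baire} id (cons m)
  c = cons-c m {id} oracle₁

≤T-shift : ∀ {x z} → x ≤T (z ∘ suc) → x ≤T z
≤T-shift {x} {z} x≤ = ≤T-trans x≤ (Comp₁-≤T (shift-c {x = λ _ → z} oracle₁))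

IncomparablePair : MassProblem → MassProblem → Set₁
IncomparablePair 𝒜 ℬ = Σ MassProblem (λ 𝒳 → Σ MassProblem (λ 𝒴 →
  ((𝒜 <M 𝒳) × (𝒳 <M ℬ)) × ((𝒜 <M 𝒴) × (𝒴 <M ℬ)) × (𝒳 |M 𝒴)))

-- Strictness comes for free: `Y ≤M A` would give `Y ≤M Z` through `A`, and `B ≤M Y` would give
-- `Z ≤M Y` through `B`; likewise for `Z`.
incomparablePair : ∀ {A B Y Z} → A ≤M Y → Y ≤M B → A ≤M Z → Z ≤M B → Y |M Z → IncomparablePair A B
incomparablePair {Y = Y} {Z} A≤Y Y≤B A≤Z Z≤B (Y≰Z , Z≰Y) =
  Y , Z ,
  ((A≤Y , λ Y≤A → Y≰Z (≤M-trans Y≤A A≤Z)) , (Y≤B , λ B≤Y → Z≰Y (≤M-trans Z≤B B≤Y))) ,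
  ((A≤Z , λ Z≤A → Z≰Y (≤M-trans Z≤A A≤Y)) , (Z≤B , λ B≤Z → Y≰Z (≤M-trans Y≤B B≤Z))) ,
  (Y≰Z , Z≰Y)

module _ (em : ExcludedMiddle 0ℓ) where

  -- Members are told apart by finitely many values. If `c` and `c′` differ at `a`, testing `y a`
  -- removes one of them; if they agree everywhere, `c′` is redundant. A single remaining function
  -- comes with its own code.
  separate : ∀ {B} c L → Cone B c → All (Cone B) L → B ≤M finite (c ∷ L)
  separate c [] (b , Bb , e , h) [] =
    e , λ { y (here y≗c) → b , (λ n → Eval-≗ y≗c (h n)) , Bb }
  separate {B} c (c′ ∷ L) Bc (Bc′ ∷ BL) with em {Σ ℕ λ a → c a ≢ c′ a}
  ... | no c≗c′ = ≤M-trans (separate c L Bc BL) (⊆⇒≤M λ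
          { y (here y≗c) → here y≗c
          ; y (there (here y≗c′)) →
              here λ n → trans (y≗c′ n) (sym (decidable-stable (c n ≟ c′ n) λ ne → c≗c′ (n , ne)))
          ; y (there (there y∈L)) → there y∈L })
  ... | yes (a , ne) = branch a (c a)
          (≤M-trans (separate c L Bc BL) (⊆⇒≤M λ
            { y (here y≗c , _) → here y≗c
            ; y (there (here y≗c′) , ya) → ⊥-elim (ne (trans (sym ya) (y≗c′ a)))
            ; y (there (there y∈L) , _) → there y∈L }))
          (≤M-trans (separate c′ L Bc′ BL) (⊆⇒≤M λ
            { y (here y≗c , ya) → ⊥-elim (ya (y≗c a))
            ; y (there y∈ , _) → y∈ }))

  finite-in-cone : ∀ {B} L → All (Cone B) L → B ≤M finite L
  finite-in-cone []      []        = zer , λ _ ()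
  finite-in-cone (c ∷ L) (Bc ∷ BL) = separate c L Bc BL

  -- If no member escaped, `e` would reduce `B ⊓ finite L` to `P`. The elements of `L` have tails in
  -- `P`, hence compute members of `B`, so `B ≤M P` would follow.
  cone⇒evading : ∀ {P B} → ¬ (B ≤M P) → (∀ f → P f → Cone B f) → Evading P B
  cone⇒evading {P} {B} B≰P P⊆B L PL e m = decidable-stable em λ none →
    B≰P (≤M-trans (meet-greatest {B} {finite L} ≤M-refl (finite-in-cone L (All.map inCone PL)))
      (relativize (proj₁ (cons-code m)) e , λ f Pf →
        let (g , eg , q) = decidable-stable (em {Hits e (cons m f) (B ⊓ finite L)}) λ miss →
                              none (f , Pf , miss) in
        g , (λ n → relativize-eval (proj₂ (cons-code m) f) (eg n)) , q))
    where
    inCone : ∀ {z} → P (z ∘ suc) → Cone B z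
    inCone {z} Pz = let (b , Bb , b≤) = P⊆B (z ∘ suc) Pz in b , Bb , ≤T-shift {z = z} b≤

  -- The stage construction.

  module Construction {P B : MassProblem} (evade : Evading P B) where

    -- The side that receives the element, its tag, and the underlying member of `P`.
    Entry : Set
    Entry = Bool × ℕ × Σ Baire P

    element : Entry → Baire
    element (_ , m , f , _) = cons m f

    select : Bool → List Entry → List Baire
    select s [] = []
    select s (x ∷ L) with s Bool.≟ proj₁ x
    ... | yes _ = element x ∷ select s L
    ... | no  _ = select s L

    select-P : ∀ s L → All (λ z → P (z ∘ suc)) (select s L)
    select-P s [] = []
    select-P s (x@(_ , _ , _ , Pf) ∷ L) with s Bool.≟ proj₁ x
    ... | yes _ = Pf ∷ select-P s L
    ... | no  _ = select-P s L

    select-∈ : ∀ {x} L → x ∈ L → ∀ {y} → (∀ n → y n ≡ element x n) → finite (select (proj₁ x) L) y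
    select-∈ {x} (.x ∷ L) (here refl) eq with proj₁ x Bool.≟ proj₁ x
    ... | yes _ = here eq
    ... | no ne = ⊥-elim (ne refl)
    select-∈ {x} (x′ ∷ L) (there x∈L) eq with proj₁ x Bool.≟ proj₁ x′
    ... | yes _ = there (select-∈ L x∈L eq)
    ... | no  _ = select-∈ L x∈L eq

    -- Requirement `n`: the functional must not reduce `B ⊓ C (not s)` to `C s`, where `s` is the
    -- side.
    request : ℕ → Bool × Code 1
    request n = (π₁ n ≡ᵇ 0) , code (π₂ n)

    request-complete : ∀ s e → Σ ℕ λ n → proj₁ (request n) ≡ s × e ⊑ proj₂ (request n)
    request-complete s e with code-complete e
    ... | t , e⊑ = pair (if s then 0 else 1) t , side s ,
                   subst (λ t → e ⊑ code t) (sym (π₂-pair (if s then 0 else 1) t)) e⊑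
      where
      side : ∀ s → (π₁ (pair (if s then 0 else 1) t) ≡ᵇ 0) ≡ s
      side true  = cong (_≡ᵇ 0) (π₁-pair 0 t)
      side false = cong (_≡ᵇ 0) (π₁-pair 1 t)

    -- In an output `g`, position 0 holds the bit of the meet and position 1 the tag. Later tags
    -- exceed `g 1`, so `g` never names an element added later.
    newBound : ∀ {e f} → Dec (Σ Baire λ g → e ⟨ f ⟩≃ g) → ℕ → ℕ
    newBound (yes (g , _)) m = suc (m ⊔ g 1)
    newBound (no _)        m = suc m

    newBound-mono : ∀ {e f} (d : Dec (Σ Baire λ g → e ⟨ f ⟩≃ g)) m → m ≤ newBound d m
    newBound-mono (yes (g , _)) m = ≤-trans (m≤m⊔n m (g 1)) (n≤1+n _)
    newBound-mono (no _)        m = n≤1+n m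

    newBound-> : ∀ {e f g} (d : Dec (Σ Baire λ g → e ⟨ f ⟩≃ g)) m →
                 e ⟨ f ⟩≃ g → g 1 < newBound d m
    newBound-> (yes (g′ , eg′)) m eg
      rewrite Eval-deterministic (eg 1) (eg′ 1) = s≤s (m≤n⊔m m (g′ 1))
    newBound-> (no none) m eg = ⊥-elim (none (_ , eg))

    mutual
      entries : ℕ → List Entry
      entries zero    = []
      entries (suc n) = entryAt n ∷ entries n

      bound : ℕ → ℕ
      bound zero    = 0
      bound (suc n) = newBound {proj₂ (request n)} {element (entryAt n)} em (bound n)

      chosen : ∀ n → Σ Baire λ f → P f × ¬ Hits (proj₂ (request n)) (cons (bound n) f)
                                             (B ⊓ finite (select (not (proj₁ (request n))) (entries n)))
      chosen n = evade (select (not (proj₁ (request n))) (entries n)) (select-P _ (entries n))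
                       (proj₂ (request n)) (bound n)

      entryAt : ℕ → Entry
      entryAt n = proj₁ (request n) , bound n , proj₁ (chosen n) , proj₁ (proj₂ (chosen n))

    entryAt-∈ : ∀ {k n} → k < n → entryAt k ∈ entries n
    entryAt-∈ {k} {suc n} k<1+n with m≤n⇒m<n∨m≡n (≤-pred k<1+n)
    ... | inj₁ k<n  = there (entryAt-∈ k<n)
    ... | inj₂ refl = here refl

    bound-mono : ∀ {n k} → n ≤ k → bound n ≤ bound k
    bound-mono {n} {zero} z≤n = ≤-refl
    bound-mono {n} {suc k} n≤1+k with m≤n⇒m<n∨m≡n n≤1+k
    ... | inj₁ n<1+k = ≤-trans (bound-mono (≤-pred n<1+k)) (newBound-mono em (bound k))
    ... | inj₂ refl  = ≤-refl

    C : Bool → MassProblem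
    C s y = Σ ℕ λ n → proj₁ (request n) ≡ s × (∀ i → y i ≡ element (entryAt n) i)

    P≤C : ∀ s → P ≤M C s
    P≤C s = ≤M-intro {C s} {P} (λ { (y , n , _) → proj₁ (chosen n) })
      (comp-ext (λ { (y , n , _ , eq) v → eq (suc (lookup v zero)) }) (shift-c {x = proj₁} oracle₁))
      (λ { (y , n , _) → proj₁ (proj₂ (chosen n)) })

    -- The element added for `e` is mapped neither into `B` nor to an earlier element of the other
    -- side, by choice. Its image is not the element of the same stage, which lies on side `s`, nor
    -- a later one, whose tag is too large.
    not-below : ∀ s → ¬ ((B ⊓ C (not s)) ≤M C s)
    not-below s (e , h) with request-complete s e
    ... | n , refl , e⊑ with h (element (entryAt n)) (n , refl , λ i → refl)
    ...   | g , eg , inj₁ Bg = proj₂ (proj₂ (chosen n)) (g , (λ i → e⊑ (eg i)) , inj₁ Bg)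
    ...   | g , eg , inj₂ (g0 , k , side , eq) with <-cmp k n
    ...     | tri< k<n _ _ = proj₂ (proj₂ (chosen n)) (g , (λ i → e⊑ (eg i)) , inj₂ (g0 ,
                subst (λ s → finite (select s (entries n)) (g ∘ suc)) side
                  (select-∈ (entries n) (entryAt-∈ k<n) eq)))
    ...     | tri≈ _ refl _ = Bool.not-¬ {proj₁ (request n)} refl (sym (trans (sym side) refl))
    ...     | tri> _ _ n<k = <⇒≱ (newBound-> em (bound n) (λ i → e⊑ (eg i)))
                (≤-trans (bound-mono n<k) (≤-reflexive (sym (eq 0))))

  -- The pair is built below `B`; the separate upper end `B′` allows `B` to be the intermediate
  -- problem of the interval.
  evading⇒pair : ∀ {A P B B′} → Evading P B → A ≤M P → A ≤M B → B ≤M B′ → IncomparablePair A B′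
  evading⇒pair {A} {P} {B} {B′} evade A≤P A≤B B≤B′ =
    incomparablePair {Y = B ⊓ C true} {B ⊓ C false} (lower true) (upper true) (lower false) (upper false)
      ((λ le → not-below false (≤M-trans le (meet-lowerʳ {B} {C false}))) ,
       (λ le → not-below true (≤M-trans le (meet-lowerʳ {B} {C true}))))
    where
    open Construction {P} {B} evade
    lower : ∀ s → A ≤M (B ⊓ C s)
    lower s = meet-greatest {B} {C s} A≤B (≤M-trans A≤P (P≤C s))
    upper : ∀ s → (B ⊓ C s) ≤M B′
    upper s = ≤M-trans (meet-lowerˡ {B} {C s}) B≤B′

-- Finite variants

-- Values of q, and hence those of override, are shifted by one as above.
override : ℕ → Baire → (ℕ → ℕ) → ℕ → ℕ
override zero    x q i       = q i
override (suc k) x q zero    = suc (x 0)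
override (suc k) x q (suc i) = override k (x ∘ suc) (q ∘ suc) i

override-below : ∀ k x q i → i < k → override k x q i ≡ suc (x i)
override-below (suc k) x q zero    _         = refl
override-below (suc k) x q (suc i) (s≤s i<k) = override-below k (x ∘ suc) (q ∘ suc) i i<k

override-above : ∀ k x q i → k ≤ i → override k x q i ≡ q i
override-above zero    x q i       _         = refl
override-above (suc k) x q (suc i) (s≤s k≤i) = override-above k (x ∘ suc) (q ∘ suc) i k≤i

override-c : ∀ {I : Set} {o : I → Baire} k x {q : ℕ → ℕ → ℕ} →
             Comp o {2} (λ i w → q (lookup w zero) (lookup w (suc zero))) →
             Comp o {2} (λ i w → override k x (q (lookup w zero)) (lookup w (suc zero)))
override-c zero x q-c = q-c
override-c (suc k) x {q} q-c =
  comp-ext (λ { i (u ∷ zero ∷ []) → refl ; i (u ∷ suc n ∷ []) → refl })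
    (rec-c (λ i w → override k (x ∘ suc) (q (lookup w (suc (suc zero))) ∘ suc) (lookup w zero))
      (const-c (suc (x 0)))
      (override-c k (x ∘ suc) {λ u → q u ∘ suc} (q-c ⟦ var zero ◂ suc-c (var (suc zero)) ◂ nil ⟧)
        ⟦ var (suc (suc zero)) ◂ var zero ◂ nil ⟧)
      (var (suc zero)))

_=*_ : Baire → Baire → Set
x =* y = Σ ℕ λ a → ∀ n → a ≤ n → x n ≡ y n

=*-refl : ∀ {x} → x =* x
=*-refl = 0 , λ n _ → refl

=*-sym : ∀ {x y} → x =* y → y =* x
=*-sym (a , eq) = a , λ n a≤n → sym (eq n a≤n)

-- The finitely many values where `x` may differ from `y` are written into the code.
=*-≤T : ∀ {x y z} → x =* y → y ≤T z → x ≤T z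
=*-≤T {x} {y} {z} (a , eq) y≤z =
  Comp₁-≤T (comp-ext (λ i v → value (lookup v zero))
    (pred-c (override-c a x {λ _ n → suc (y n)} (suc-c (app {x = λ _ → y} (≤T-Comp₁ y≤z) (var (suc zero))))
      ⟦ const-c 0 ◂ var zero ◂ nil ⟧)))
  where
  value : ∀ n → pred (override a x (suc ∘ y) n) ≡ x n
  value n with n <? a
  ... | yes n<a = cong pred (override-below a x _ n n<a)
  ... | no  n≮a = trans (cong pred (override-above a x _ n (≮⇒≥ n≮a))) (sym (eq n (≮⇒≥ n≮a)))

join : Baire → Baire → Baire
join f x n = pair (f n) (x n)

join-least : ∀ {f x z} → f ≤T z → x ≤T z → join f x ≤T z
join-least {f} {x} f≤z x≤z =
  Comp₁-≤T (pair-c (app {x = λ _ → f} (≤T-Comp₁ f≤z) (var zero)) (app {x = λ _ → x} (≤T-Comp₁ x≤z) (var zero)))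

join-upperʳ : ∀ {f x} → x ≤T join f x
join-upperʳ {f} {x} = Comp₁-≤T (comp-ext (λ i v → π₂-pair (f (lookup v zero)) _) (π₂-c (oracle (var zero))))

-- Members compute f uniformly, but c only nonuniformly.
Variants : Baire → Baire → MassProblem
Variants f c y = Σ Baire λ x → x =* c × (∀ n → y n ≡ join f x n)

module _ {f c : Baire} (e : Code 1) where

  -- f searches for a finite string extending x₀ ↾ k on which e converges; the value found is correct
  -- because every such string extends to a finite variant of c.
  computable-from-base : ∀ {z x₀ k} → x₀ =* c →
    (∀ n → Σ ℕ λ v → Eval (join f x₀) e (n ∷ []) v) →
    (correct : ∀ x → x =* c → (∀ i → i < k → x i ≡ x₀ i) →
               ∀ n v → Eval (join f x) e (n ∷ []) v → v ≡ z n) →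
    z ≤T f
  computable-from-base {z} {x₀} {k} x₀=*c total correct =
    Comp₁-≤T (comp-ext (λ { i (n ∷ []) → value i n }) (pred-c (ev-c (λ _ → oracles) oracles-c e ⟦ M-c ◂ ids ⟧)))
    where
    o : ℕ → Baire
    o _ = f

    digit : ℕ → ℕ → ℕ
    digit u = override k x₀ (string u)

    oracles : ℕ → ℕ → ℕ
    oracles u n = ifz (digit u n) 0 (suc (pair (f n) (pred (digit u n))))

    digit-c : Comp o {2} (λ i w → digit (lookup w zero) (lookup w (suc zero)))
    digit-c = override-c k x₀ {string} (string-c (var zero) (var (suc zero)))

    oracles-c : Comp o {2} (λ i w → oracles (lookup w zero) (lookup w (suc zero)))
    oracles-c = ifz-c digit-c (const-c 0) (suc-c (pair-c (oracle (var (suc zero))) (pred-c digit-c)))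

    -- Filling the undefined places from `c` yields a finite variant of `c`. It serves only the
    -- correctness argument and is not computed.
    extension : ℕ → Baire
    extension u n = ifz (digit u n) (c n) (pred (digit u n))

    extension-=* : ∀ u → extension u =* c
    extension-=* u = k ⊔ π₁ u , λ n ≤n →
      cong (λ d → ifz d (c n) (pred d))
        (trans (override-above k x₀ _ n (≤-trans (m≤m⊔n k (π₁ u)) ≤n))
               (string-finite u n (≤-trans (m≤n⊔m k (π₁ u)) ≤n)))

    extension-below : ∀ u i → i < k → extension u i ≡ x₀ i
    extension-below u i i<k = cong (λ d → ifz d (c i) (pred d)) (override-below k x₀ _ i i<k)

    oracles-⊑ : ∀ u i v → oracles u i ≡ suc v → join f (extension u) i ≡ v
    oracles-⊑ u i v eq with digit u i
    ... | suc d = suc-injective eq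

    -- Zero exactly when the run with clock and string `u` converges.
    F : ℕ → Vec ℕ 2 → ℕ
    F _ w = ifz (ev (lookup w zero) (oracles (lookup w zero)) e (tail w)) 1 0

    converges : ∀ (i : ℕ) v → Σ ℕ λ u → F i (u ∷ v) ≡ 0
    converges i (n ∷ []) with ev-complete (proj₂ (total n))
    ... | N , h with string-complete x₀ N
    ...   | u , N≤u , agree = u , cong (λ r → ifz r 1 0) (h u (oracles u) N≤u agrees)
      where
      digits : ∀ i → i < N → digit u i ≡ suc (x₀ i)
      digits i i<N with i <? k
      ... | yes i<k = override-below k x₀ _ i i<k
      ... | no  i≮k = trans (override-above k x₀ _ i (≮⇒≥ i≮k)) (agree i i<N)
      agrees : Agree (oracles u) (join f x₀) N
      agrees i i<N = cong (λ d → ifz d 0 (suc (pair (f i) (pred d)))) (digits i i<N)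

    found : Σ (ℕ → Vec ℕ 1 → ℕ) λ M → Comp o M × (∀ i v → F i (M i v ∷ v) ≡ 0)
    found = search-c F (ifz-c (ev-c (λ _ → oracles) oracles-c e) (const-c 1) (const-c 0)) converges

    M   = proj₁ found
    M-c = proj₁ (proj₂ found)

    value : ∀ i n → pred (ev (M i (n ∷ [])) (oracles (M i (n ∷ []))) e (n ∷ [])) ≡ z n
    value i n with M i (n ∷ []) | proj₂ (proj₂ found) i (n ∷ [])
    ... | u | F≡0 with ev u (oracles u) e (n ∷ []) in eq
    ...   | suc v = correct (extension u) (extension-=* u) (extension-below u) n v
                      (ev-sound (oracles-⊑ u) e (n ∷ []) eq)

  -- Induction on `L`. Since `z` is not computable from `f`, some variant extending the current
  -- string gives an output value different from that of `z`. Prolonging the string by the use of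
  -- this computation rules out `z` for all further variants.
  variants-escape : ExcludedMiddle 0ℓ → ∀ L → All (λ z → ¬ (z ≤T f)) L → ∀ x₀ k → x₀ =* c →
    ¬ (∀ x → x =* c → (∀ i → i < k → x i ≡ x₀ i) → Hits e (join f x) (finite L))
  variants-escape em [] [] x₀ k x₀=*c hits with hits x₀ x₀=*c (λ _ _ → refl)
  ... | _ , _ , ()
  variants-escape em (z ∷ L) (z≰f ∷ L≰f) x₀ k x₀=*c hits
    with em {Σ Baire λ x → x =* c × (∀ i → i < k → x i ≡ x₀ i) ×
             Σ ℕ λ n → Σ ℕ λ v → Eval (join f x) e (n ∷ []) v × v ≢ z n}
  ... | no none = z≰f (computable-from-base x₀=*c
          (λ n → let (g , eg , _) = hits x₀ x₀=*c (λ _ _ → refl) in g n , eg n)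
          (λ x x=*c agree n v d → decidable-stable (v ≟ z n) λ ne → none (x , x=*c , agree , n , v , d , ne)))
  ... | yes (x , x=*c , agree , n , v , d , v≢zn) with Eval-use d
  ...   | N , use = variants-escape em L L≰f x (k ⊔ N) x=*c λ x′ x′=*c agree′ →
            let (g , eg , g∈) = hits x′ x′=*c (λ i i<k →
                                  trans (agree′ i (<-≤-trans i<k (m≤m⊔n k N))) (agree i i<k))
                d′ = use (join f x′) (λ i i<N → cong (pair (f i)) (agree′ i (<-≤-trans i<N (m≤n⊔m k N))))
            in g , eg , rest g (Eval-deterministic (eg n) d′) g∈
    where
    rest : ∀ g → g n ≡ v → finite (z ∷ L) g → finite L g
    rest g gn≡v (here g≗z)  = ⊥-elim (v≢zn (trans (sym gn≡v) (g≗z n)))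
    rest g gn≡v (there g∈L) = g∈L

-- An output in `B` is impossible because `c` computes every member of `Variants f c`. An element of
-- `L` computable from `f` would give `f` a finite variant of `c`, hence `c`.
variants-evading : ExcludedMiddle 0ℓ → ∀ {B f c} → f ≤T c → ¬ (c ≤T f) → ¬ Cone B c →
                   Evading (Variants f c) B
variants-evading em {B} {f} {c} f≤c c≰f c∉B L VL e m = decidable-stable em λ none →
  variants-escape (relativize (proj₁ (cons-code m)) e′) em L (All.map incomputable VL) c 0 =*-refl
    λ x x=*c _ →
      let (g , eg , q) = decidable-stable (em {Hits e (cons m (join f x)) (B ⊓ finite L)}) λ miss →
                            none (join f x , (x , x=*c , λ _ → refl) , miss)
      in g ∘ suc ,
         (λ n → relativize-eval (proj₂ (cons-code m) (join f x))
                  (e-comp {ys = suc n ∷ []} (λ { zero → e-suc }) (eg (suc n)))) ,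
         finitePart x x=*c g (relativize (proj₁ (cons-code m)) e ,
           λ n → relativize-eval (proj₂ (cons-code m) (join f x)) (eg n)) q
  where
  e′ : Code 1
  -- The shift removes the bit of the meet from the output.
  e′ = comp e (λ _ → sucᶜ)

  incomputable : ∀ {z} → Variants f c (z ∘ suc) → ¬ (z ≤T f)
  incomputable {z} (x , x=*c , eq) z≤f = c≰f (=*-≤T (=*-sym x=*c) (≤T-trans (join-upperʳ {f})
    (≤T-trans {z = f} (Comp₁-≤T (comp-ext (λ i v → eq (lookup v zero)) (shift-c {x = λ _ → z} oracle₁))) z≤f)))

  finitePart : ∀ x → x =* c → ∀ g → g ≤T join f x → (B ⊓ finite L) g → finite L (g ∘ suc)
  finitePart x x=*c g g≤ (inj₂ (_ , g∈L)) = g∈L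
  finitePart x x=*c g g≤ (inj₁ (_ , Bg)) = ⊥-elim (c∉B (g ∘ suc , Bg ,
    ≤T-trans (Comp₁-≤T (shift-c {x = λ _ → g} oracle₁))
      (≤T-trans g≤ (join-least f≤c (=*-≤T x=*c (orc , λ n → e-orc))))))

theorem8p4 : ExcludedMiddle 0ℓ → (𝒜 ℬ : MassProblem) →
    Σ MassProblem (λ 𝒳 → (𝒜 <M 𝒳) × (𝒳 <M ℬ)) →
    Σ MassProblem (λ 𝒳 → Σ MassProblem (λ 𝒴 →
    ((𝒜 <M 𝒳) × (𝒳 <M ℬ)) × ((𝒜 <M 𝒴) × (𝒴 <M ℬ)) × (𝒳 |M 𝒴)))
theorem8p4 em 𝒜 ℬ (𝒳 , (𝒜≤𝒳 , 𝒳≰𝒜) , (𝒳≤ℬ , ℬ≰𝒳))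
  with em {Σ Baire λ f → 𝒜 f × ¬ Cone 𝒳 f} | em {Σ Baire λ c → 𝒳 c × ¬ Cone ℬ c}
-- Every member of `𝒜` computes one of `𝒳`, so `𝒜` evades `𝒳` and the pair lies between these two.
... | no none | _ =
  evading⇒pair em (cone⇒evading em 𝒳≰𝒜 λ f 𝒜f → decidable-stable em λ f∉ → none (f , 𝒜f , f∉))
    ≤M-refl 𝒜≤𝒳 𝒳≤ℬ
-- Here `𝒳` evades `ℬ`.
... | yes _ | no none =
  evading⇒pair em (cone⇒evading em ℬ≰𝒳 λ c 𝒳c → decidable-stable em λ c∉ → none (c , 𝒳c , c∉))
    𝒜≤𝒳 (≤M-trans 𝒜≤𝒳 𝒳≤ℬ) ≤M-refl
... | yes (f , 𝒜f , f∉𝒳) | yes (c , 𝒳c , c∉ℬ) = byComparing em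
  where
  𝒜≤ℬ : 𝒜 ≤M ℬ
  𝒜≤ℬ = ≤M-trans 𝒜≤𝒳 𝒳≤ℬ

  c≰f : ¬ (c ≤T f)
  c≰f c≤f = f∉𝒳 (c , 𝒳c , c≤f)

  f∉ℬ : ¬ Cone ℬ f
  f∉ℬ (b , ℬb , b≤f) =
    let (x , ex , 𝒳x) = proj₂ 𝒳≤ℬ b ℬb in f∉𝒳 (x , 𝒳x , ≤T-trans (proj₁ 𝒳≤ℬ , ex) b≤f)

  Point : Baire → MassProblem
  Point x = finite (x ∷ [])

  above : ∀ {x} → Cone 𝒜 x → 𝒜 ≤M (ℬ ⊓ Point x)
  above {x} 𝒜x = meet-greatest {ℬ} {Point x} 𝒜≤ℬ (finite-in-cone em (x ∷ []) (𝒜x ∷ []))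

  -- The image of `y` would make `y` compute either a member of `ℬ` or `x`.
  not-below : ∀ {x y} → ¬ (x ≤T y) → ¬ Cone ℬ y → ¬ ((ℬ ⊓ Point x) ≤M (ℬ ⊓ Point y))
  not-below {x} {y} x≰y y∉ℬ le
    with ≤M-trans le (meet-lowerʳ {ℬ} {Point y})
  ... | e , h with h y (here λ _ → refl)
  ...   | g , eg , inj₁ (_ , ℬg) = y∉ℬ (_ , ℬg , tail≤ g (e , eg))
    where
    tail≤ : ∀ g → g ≤T y → (g ∘ suc) ≤T y
    tail≤ g = ≤T-trans (Comp₁-≤T (shift-c {x = λ _ → g} oracle₁))
  ...   | g , eg , inj₂ (_ , here eq) = x≰y (≤T-trans
            (Comp₁-≤T (comp-ext (λ i v → eq (lookup v zero)) (shift-c {x = λ _ → g} oracle₁))) (e , eg))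

  𝒜≤Variants : 𝒜 ≤M Variants f c
  𝒜≤Variants = ≤M-intro {Variants f c} {𝒜} (λ _ → f)
    (comp-ext (λ { (y , x , _ , eq) v → trans (cong π₁ (eq (lookup v zero))) (π₁-pair _ (x (lookup v zero))) })
      (π₁-c (oracle (var zero))))
    (λ _ → 𝒜f)

  byComparing : Dec (f ≤T c) → IncomparablePair 𝒜 ℬ
  byComparing (yes f≤c) = evading⇒pair em (variants-evading em f≤c c≰f c∉ℬ) 𝒜≤Variants 𝒜≤ℬ ≤M-refl
  byComparing (no f≰c)  =
    incomparablePair {Y = ℬ ⊓ Point c} {ℬ ⊓ Point f}
      (above (let (a , ea , 𝒜a) = proj₂ 𝒜≤𝒳 c 𝒳c in a , 𝒜a , proj₁ 𝒜≤𝒳 , ea)) (meet-lowerˡ {ℬ} {Point c})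
      (above (f , 𝒜f , orc , λ n → e-orc)) (meet-lowerˡ {ℬ} {Point f})
      (not-below c≰f f∉ℬ , not-below f≰c c∉ℬ)
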